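{- For every natural number $m\ge 2$, there exists a finite simple graph $G$ such that its Randić energy satisfies $RE(G)=m$.
   Context: For a finite simple graph $G$ with vertices $v_1,\dots,v_n$ of degrees $d_1,\dots,d_n$, the Randić matrix $R(G)$ is the $n\times n$ real symmetric matrix with $(i,j)$-entry $\frac{1}{\sqrt{d_id_j}}$ if $v_i$ and $v_j$ are adjacent, and $0$ otherwise. The Randić energy of $G$ is $RE(G)=\sum_{i=1}^n|\rho_i|$, where $\rho_1,\dots,\rho_n$ are the eigenvalues of $R(G)$ counted with multiplicity. -}

module Defs where

open import Algebra.Bundles.Raw using (RawRing)
import Algebra.Definitions.RawMonoid as RawMonoidDefs
import Algebra.Definitions.RawSemiring as RawSemiringDefs
open import Data.Bool using (Bool; false; if_then_else_)
open import Data.Fin using (Fin; zero; suc; toℕ; punchIn)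
import Data.Fin as Fin
open import Data.Fin.Subset using (Subset)
import Data.Fin.Subset as Subset
open import Data.Integer using (+_)
import Data.Integer as ℤ
import Data.Integer.Properties as ℤ
open import Data.Integer.Solver using () renaming (module +-*-Solver to ℤ-Solver)
open import Data.Nat as ℕ using (ℕ; zero; suc)
import Data.Nat.Properties as ℕ
open import Data.Product using (Σ; ∃; _×_; _,_; proj₁; proj₂)
open import Data.Rational
open import Data.Rational.Properties
open import Data.Rational.Solver using (module +-*-Solver)
import Data.Rational.Unnormalised as ℚᵘ
import Data.Rational.Unnormalised.Properties as ℚᵘ
open import Data.Sum using (inj₁; inj₂)
open import Data.Vec using (tabulate)
open import Data.Vec.Functional using (Vector)
open import Level using (0ℓ) renaming (_⊔_ to _⊔ˡ_)
open import Relation.Binary.PropositionalEquality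
open import Relation.Nullary using (does; yes; no; contradiction)

Cauchy : (ℕ → ℚ) → Set
Cauchy s = ∀ ε → 0ℚ < ε →
  ∃ λ N → ∀ m n → N ℕ.≤ m → N ℕ.≤ n → ∣ s m - s n ∣ < ε

-- Equality of reals is _≃ᴿ_, not _≡_.
record ℝ : Set where
  constructor mkℝ
  field
    seq    : ℕ → ℚ
    cauchy : Cauchy seq

open ℝ public

infix 4 _≃ᴿ_

_≃ᴿ_ : ℝ → ℝ → Set
x ≃ᴿ y = ∀ ε → 0ℚ < ε →
  ∃ λ N → ∀ n → N ℕ.≤ n → ∣ seq x n - seq y n ∣ < ε

-- |x| ≥ δ for some rational δ > 0; constructively this is what
-- invertibility of x amounts to.
Apart₀ : ℝ → Set
Apart₀ x = ∃ λ δ → 0ℚ < δ × ∃ λ N → ∀ n → N ℕ.≤ n → δ ≤ ∣ seq x n ∣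

half>0 : ∀ {ε} → 0ℚ < ε → 0ℚ < ½ * ε
half>0 {ε} ε>0 = positive⁻¹ (½ * ε) {{pos*pos⇒pos ½ ε {{positive ε>0}}}}

half+half : ∀ ε → ½ * ε + ½ * ε ≡ ε
half+half ε = trans (sym (*-distribʳ-+ ε ½ ½)) (*-identityˡ ε)

*>0 : ∀ {p q} → 0ℚ < p → 0ℚ < q → 0ℚ < p * q
*>0 {p} {q} p>0 q>0 = positive⁻¹ (p * q) {{pos*pos⇒pos p {{positive p>0}} q {{positive q>0}}}}

neg-minus : ∀ p q → - (p - q) ≡ q - p
neg-minus = solve 2 (λ p q → :- (p :- q) := q :- p) refl
  where open +-*-Solver

∣-∣-sym : ∀ p q → ∣ p - q ∣ ≡ ∣ q - p ∣
∣-∣-sym p q = trans (sym (∣-p∣≡∣p∣ (p - q))) (cong ∣_∣ (neg-minus p q))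

∣-∣-bound : ∀ p q {r} → p - q ≤ r → q - p ≤ r → ∣ p - q ∣ ≤ r
∣-∣-bound p q {r} p-q≤r q-p≤r with ∣p∣≡p∨∣p∣≡-p (p - q)
... | inj₁ e = subst (_≤ r) (sym e) p-q≤r
... | inj₂ e = subst (_≤ r) (sym (trans e (neg-minus p q))) q-p≤r

*-mono-≤₀ : ∀ {p q r s} → 0ℚ ≤ r → 0ℚ ≤ q → p ≤ q → r ≤ s → p * r ≤ q * s
*-mono-≤₀ {p} {q} {r} {s} r≥0 q≥0 p≤q r≤s = ≤-trans
  (*-monoʳ-≤-nonNeg r {{nonNegative r≥0}} p≤q)
  (*-monoˡ-≤-nonNeg q {{nonNegative q≥0}} r≤s)

fromℚ : ℚ → ℝ
fromℚ q = mkℝ (λ _ → q) λ ε ε>0 →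
  0 , λ _ _ _ _ → subst (λ z → ∣ z ∣ < ε) (sym (+-inverseʳ q)) ε>0

fromℕ : ℕ → ℝ
fromℕ n = fromℚ (+ n / 1)

infixl 6 _+ᴿ_
infixl 7 _*ᴿ_
infix  8 -ᴿ_

_+ᴿ_ : ℝ → ℝ → ℝ
x +ᴿ y = mkℝ (λ n → seq x n + seq y n) λ ε ε>0 →
  let (M , x-close) = cauchy x (½ * ε) (half>0 ε>0)
      (N , y-close) = cauchy y (½ * ε) (half>0 ε>0)
  in M ℕ.⊔ N , λ m n ≤m ≤n →
    let a = seq x m; b = seq x n; c = seq y m; d = seq y n in
    begin-strict
      ∣ (a + c) - (b + d) ∣   ≡⟨ cong ∣_∣ (lemma a b c d) ⟩
      ∣ (a - b) + (c - d) ∣   ≤⟨ ∣p+q∣≤∣p∣+∣q∣ (a - b) (c - d) ⟩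
      ∣ a - b ∣ + ∣ c - d ∣   <⟨ +-mono-<
        (x-close m n (ℕ.m⊔n≤o⇒m≤o M N ≤m) (ℕ.m⊔n≤o⇒m≤o M N ≤n))
        (y-close m n (ℕ.m⊔n≤o⇒n≤o M N ≤m) (ℕ.m⊔n≤o⇒n≤o M N ≤n)) ⟩
      ½ * ε + ½ * ε           ≡⟨ half+half ε ⟩
      ε                       ∎
  where
  open ≤-Reasoning
  lemma : ∀ a b c d → (a + c) - (b + d) ≡ (a - b) + (c - d)
  lemma = solve 4 (λ a b c d → (a :+ c) :- (b :+ d) := (a :- b) :+ (c :- d)) refl
    where open +-*-Solver

-ᴿ_ : ℝ → ℝ
-ᴿ x = mkℝ (λ n → - seq x n) λ ε ε>0 →
  let (N , close) = cauchy x ε ε>0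
  in N , λ m n ≤m ≤n →
    subst (_< ε) (trans (∣-∣-sym (seq x m) (seq x n)) (cong ∣_∣ (lemma (seq x m) (seq x n))))
      (close m n ≤m ≤n)
  where
  lemma : ∀ a b → b - a ≡ - a - - b
  lemma = solve 2 (λ a b → b :- a := :- a :- :- b) refl
    where open +-*-Solver

∣_∣ᴿ : ℝ → ℝ
∣ x ∣ᴿ = mkℝ (λ n → ∣ seq x n ∣) λ ε ε>0 →
  let (N , close) = cauchy x ε ε>0
  in N , λ m n ≤m ≤n →
    ≤-<-trans (∣∣p∣-∣q∣∣≤∣p-q∣ (seq x m) (seq x n)) (close m n ≤m ≤n)
  where
  open ≤-Reasoning
  one-sided : ∀ p q → ∣ p ∣ - ∣ q ∣ ≤ ∣ p - q ∣
  one-sided p q = begin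
    ∣ p ∣ - ∣ q ∣                   ≡⟨ cong (λ z → ∣ z ∣ - ∣ q ∣) (lemma₁ p q) ⟩
    ∣ (p - q) + q ∣ - ∣ q ∣         ≤⟨ +-monoˡ-≤ (- ∣ q ∣) (∣p+q∣≤∣p∣+∣q∣ (p - q) q) ⟩
    (∣ p - q ∣ + ∣ q ∣) - ∣ q ∣     ≡⟨ lemma₂ ∣ p - q ∣ ∣ q ∣ ⟩
    ∣ p - q ∣                       ∎
    where
    open +-*-Solver
    lemma₁ : ∀ p q → p ≡ (p - q) + q
    lemma₁ = solve 2 (λ p q → p := (p :- q) :+ q) refl
    lemma₂ : ∀ p q → (p + q) - q ≡ p
    lemma₂ = solve 2 (λ p q → (p :+ q) :- q := p) refl
  ∣∣p∣-∣q∣∣≤∣p-q∣ : ∀ p q → ∣ ∣ p ∣ - ∣ q ∣ ∣ ≤ ∣ p - q ∣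
  ∣∣p∣-∣q∣∣≤∣p-q∣ p q = ∣-∣-bound ∣ p ∣ ∣ q ∣ (one-sided p q)
    (subst (∣ q ∣ - ∣ p ∣ ≤_) (∣-∣-sym q p) (one-sided q p))

eventually-bounded : ∀ x → ∃ λ B → 0ℚ < B × ∃ λ N → ∀ n → N ℕ.≤ n → ∣ seq x n ∣ ≤ B
eventually-bounded x =
  let (N , close) = cauchy x 1ℚ (positive⁻¹ 1ℚ)
      c = seq x N
  in 1ℚ + ∣ c ∣
   , <-≤-trans (positive⁻¹ 1ℚ) (subst (_≤ 1ℚ + ∣ c ∣) (+-identityʳ 1ℚ) (+-monoʳ-≤ 1ℚ (0≤∣p∣ c)))
   , N
   , λ n N≤n → begin
       ∣ seq x n ∣                    ≡⟨ cong ∣_∣ (lemma (seq x n) c) ⟩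
       ∣ (seq x n - c) + c ∣          ≤⟨ ∣p+q∣≤∣p∣+∣q∣ (seq x n - c) c ⟩
       ∣ seq x n - c ∣ + ∣ c ∣        ≤⟨ +-monoˡ-≤ ∣ c ∣ (<⇒≤ (close n N N≤n ℕ.≤-refl)) ⟩
       1ℚ + ∣ c ∣                     ∎
  where
  open ≤-Reasoning
  lemma : ∀ p q → p ≡ (p - q) + q
  lemma = solve 2 (λ p q → p := (p :- q) :+ q) refl
    where open +-*-Solver

1/>0 : ∀ {p} (p>0 : 0ℚ < p) → ∃ λ r → 0ℚ < r × p * r ≡ 1ℚ
1/>0 {p} p>0 =
    (1/ p) {{pos⇒nonZero p {{positive p>0}}}}
  , positive⁻¹ _ {{1/pos⇒pos p {{positive p>0}}}}
  , *-inverseʳ p {{pos⇒nonZero p {{positive p>0}}}}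

_*ᴿ_ : ℝ → ℝ → ℝ
x *ᴿ y = mkℝ (λ n → seq x n * seq y n) λ ε ε>0 →
  let (B , B>0 , K , x≤B) = eventually-bounded x
      (C , C>0 , L , y≤C) = eventually-bounded y
      (B⁻¹ , B⁻¹>0 , BB⁻¹≡1) = 1/>0 B>0
      (C⁻¹ , C⁻¹>0 , CC⁻¹≡1) = 1/>0 C>0
      (M , x-close) = cauchy x (C⁻¹ * (½ * ε)) (*>0 C⁻¹>0 (half>0 ε>0))
      (N , y-close) = cauchy y (B⁻¹ * (½ * ε)) (*>0 B⁻¹>0 (half>0 ε>0))
  in (K ℕ.⊔ L) ℕ.⊔ (M ℕ.⊔ N) , λ m n ≤m ≤n →
    let a = seq x m; b = seq x n; c = seq y m; d = seq y n
        KL≤m = ℕ.m⊔n≤o⇒m≤o (K ℕ.⊔ L) (M ℕ.⊔ N) ≤m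
        KL≤n = ℕ.m⊔n≤o⇒m≤o (K ℕ.⊔ L) (M ℕ.⊔ N) ≤n
        MN≤m = ℕ.m⊔n≤o⇒n≤o (K ℕ.⊔ L) (M ℕ.⊔ N) ≤m
        MN≤n = ℕ.m⊔n≤o⇒n≤o (K ℕ.⊔ L) (M ℕ.⊔ N) ≤n
        xmn = x-close m n (ℕ.m⊔n≤o⇒m≤o M N MN≤m) (ℕ.m⊔n≤o⇒m≤o M N MN≤n)
        ymn = y-close m n (ℕ.m⊔n≤o⇒n≤o M N MN≤m) (ℕ.m⊔n≤o⇒n≤o M N MN≤n)
    in begin-strict
      ∣ a * c - b * d ∣                                   ≡⟨ cong ∣_∣ (lemma a b c d) ⟩
      ∣ a * (c - d) + d * (a - b) ∣                       ≤⟨ ∣p+q∣≤∣p∣+∣q∣ (a * (c - d)) (d * (a - b)) ⟩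
      ∣ a * (c - d) ∣ + ∣ d * (a - b) ∣                   ≡⟨ cong₂ _+_ (∣p*q∣≡∣p∣*∣q∣ a (c - d)) (∣p*q∣≡∣p∣*∣q∣ d (a - b)) ⟩
      ∣ a ∣ * ∣ c - d ∣ + ∣ d ∣ * ∣ a - b ∣               ≤⟨ +-mono-≤
        (*-monoʳ-≤-nonNeg ∣ c - d ∣ {{∣-∣-nonNeg (c - d)}} (x≤B m (ℕ.m⊔n≤o⇒m≤o K L KL≤m)))
        (*-monoʳ-≤-nonNeg ∣ a - b ∣ {{∣-∣-nonNeg (a - b)}} (y≤C n (ℕ.m⊔n≤o⇒n≤o K L KL≤n))) ⟩
      B * ∣ c - d ∣ + C * ∣ a - b ∣                       <⟨ +-mono-<
        (*-monoʳ-<-pos B {{positive B>0}} ymn)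
        (*-monoʳ-<-pos C {{positive C>0}} xmn) ⟩
      B * (B⁻¹ * (½ * ε)) + C * (C⁻¹ * (½ * ε))           ≡⟨ cong₂ _+_ (cancel B B⁻¹ (½ * ε) BB⁻¹≡1) (cancel C C⁻¹ (½ * ε) CC⁻¹≡1) ⟩
      ½ * ε + ½ * ε                                       ≡⟨ half+half ε ⟩
      ε                                                   ∎
  where
  open ≤-Reasoning
  lemma : ∀ a b c d → a * c - b * d ≡ a * (c - d) + d * (a - b)
  lemma = solve 4 (λ a b c d → a :* c :- b :* d := a :* (c :- d) :+ d :* (a :- b)) refl
    where open +-*-Solver
  cancel : ∀ p q r → p * q ≡ 1ℚ → p * (q * r) ≡ r
  cancel p q r e = trans (sym (*-assoc p q r)) (trans (cong (_* r) e) (*-identityˡ r))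

ℝ-rawRing : RawRing 0ℓ 0ℓ
ℝ-rawRing = record
  { Carrier = ℝ
  ; _≈_     = _≃ᴿ_
  ; _+_     = _+ᴿ_
  ; _*_     = _*ᴿ_
  ; -_      = -ᴿ_
  ; 0#      = fromℚ 0ℚ
  ; 1#      = fromℚ 1ℚ
  }

-- Termwise inverse; the value at 0 is irrelevant, since a sequence
-- apart from 0 has only finitely many zero terms.
invℚ : ℚ → ℚ
invℚ q with q ≟ 0ℚ
... | yes _   = 0ℚ
... | no  q≢0 = (1/ q) {{≢-nonZero q≢0}}

invℚ-inverse : ∀ {q} → q ≢ 0ℚ → q * invℚ q ≡ 1ℚ
invℚ-inverse {q} q≢0 with q ≟ 0ℚ
... | yes q≡0 = contradiction q≡0 q≢0
... | no  q≢0 = *-inverseʳ q {{≢-nonZero q≢0}}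

infix 8 _⁻¹[_]

_⁻¹[_] : (x : ℝ) → Apart₀ x → ℝ
x ⁻¹[ δ , δ>0 , K , δ≤∣x∣ ] = mkℝ (λ n → invℚ (seq x n)) λ ε ε>0 →
  let (N , close) = cauchy x (δ * δ * ε) (*>0 (*>0 δ>0 δ>0) ε>0)
  in K ℕ.⊔ N , λ m n ≤m ≤n →
    let a = seq x m; b = seq x n
        δ≤a = δ≤∣x∣ m (ℕ.m⊔n≤o⇒m≤o K N ≤m)
        δ≤b = δ≤∣x∣ n (ℕ.m⊔n≤o⇒m≤o K N ≤n)
        a⁻¹ = invℚ a; b⁻¹ = invℚ b
        aa⁻¹≡1 = invℚ-inverse (≢0 a δ≤a)
        bb⁻¹≡1 = invℚ-inverse (≢0 b δ≤b)
    in *-cancelˡ-<-nonNeg (δ * δ) {{nonNegative (<⇒≤ (*>0 δ>0 δ>0))}} (begin-strict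
      δ * δ * ∣ a⁻¹ - b⁻¹ ∣                 ≤⟨ *-monoʳ-≤-nonNeg ∣ a⁻¹ - b⁻¹ ∣ {{∣-∣-nonNeg (a⁻¹ - b⁻¹)}}
                                                 (*-mono-≤₀ (<⇒≤ δ>0) (0≤∣p∣ a) δ≤a δ≤b) ⟩
      ∣ a ∣ * ∣ b ∣ * ∣ a⁻¹ - b⁻¹ ∣         ≡⟨ cong (_* ∣ a⁻¹ - b⁻¹ ∣) (sym (∣p*q∣≡∣p∣*∣q∣ a b)) ⟩
      ∣ a * b ∣ * ∣ a⁻¹ - b⁻¹ ∣             ≡⟨ sym (∣p*q∣≡∣p∣*∣q∣ (a * b) (a⁻¹ - b⁻¹)) ⟩
      ∣ a * b * (a⁻¹ - b⁻¹) ∣               ≡⟨ cong ∣_∣ (lemma a b a⁻¹ b⁻¹) ⟩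
      ∣ (a * a⁻¹) * b - (b * b⁻¹) * a ∣     ≡⟨ cong ∣_∣ (cong₂ (λ u v → u * b - v * a) aa⁻¹≡1 bb⁻¹≡1) ⟩
      ∣ 1ℚ * b - 1ℚ * a ∣                   ≡⟨ cong ∣_∣ (cong₂ _-_ (*-identityˡ b) (*-identityˡ a)) ⟩
      ∣ b - a ∣                             ≡⟨ ∣-∣-sym b a ⟩
      ∣ a - b ∣                             <⟨ close m n (ℕ.m⊔n≤o⇒n≤o K N ≤m) (ℕ.m⊔n≤o⇒n≤o K N ≤n) ⟩
      δ * δ * ε                             ∎)
  where
  open ≤-Reasoning
  ≢0 : ∀ q → δ ≤ ∣ q ∣ → q ≢ 0ℚ
  ≢0 _ δ≤q refl = <-irrefl refl (<-≤-trans δ>0 δ≤q)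
  lemma : ∀ a b c d → a * b * (c - d) ≡ (a * c) * b - (b * d) * a
  lemma = solve 4 (λ a b c d → a :* b :* (c :- d) := (a :* c) :* b :- (b :* d) :* a) refl
    where open +-*-Solver

-- ⌊√ n ⌋ from r = ⌊√ (n - 1) ⌋; a separate function so that r is
-- evaluated only once.
√-next : ℕ → ℕ → ℕ
√-next n r with suc r ℕ.* suc r ℕ.≤? n
... | yes _ = suc r
... | no  _ = r

⌊√_⌋ : ℕ → ℕ
⌊√ zero  ⌋ = zero
⌊√ suc n ⌋ = √-next (suc n) ⌊√ n ⌋

⌊√⌋-lower : ∀ n → ⌊√ n ⌋ ℕ.* ⌊√ n ⌋ ℕ.≤ n
⌊√⌋-lower zero = ℕ.z≤n
⌊√⌋-lower (suc n) with suc ⌊√ n ⌋ ℕ.* suc ⌊√ n ⌋ ℕ.≤? suc n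
... | yes p = p
... | no  _ = ℕ.m≤n⇒m≤1+n (⌊√⌋-lower n)

⌊√⌋-upper : ∀ n → n ℕ.< suc ⌊√ n ⌋ ℕ.* suc ⌊√ n ⌋
⌊√⌋-upper zero = ℕ.s≤s ℕ.z≤n
⌊√⌋-upper (suc n) with suc ⌊√ n ⌋ ℕ.* suc ⌊√ n ⌋ ℕ.≤? suc n
... | yes _ = ℕ.≤-<-trans (⌊√⌋-upper n) (ℕ.*-mono-< (ℕ.n<1+n (suc ⌊√ n ⌋)) (ℕ.n<1+n (suc ⌊√ n ⌋)))
... | no ¬p = ℕ.≰⇒> ¬p

square-cancel-< : ∀ {m n} → m ℕ.* m ℕ.< n ℕ.* n → m ℕ.< n
square-cancel-< {m} {n} m²<n² with m ℕ.<? n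
... | yes m<n = m<n
... | no  m≮n = contradiction (ℕ.*-mono-≤ (ℕ.≮⇒≥ m≮n) (ℕ.≮⇒≥ m≮n)) (ℕ.<⇒≱ m²<n²)

/-mono-≤ : ∀ a b k l → a ℕ.* suc l ℕ.≤ b ℕ.* suc k → + a / suc k ≤ + b / suc l
/-mono-≤ a b k l le = toℚᵘ-cancel-≤
  (ℚᵘ.≤-respʳ-≃ (ℚᵘ.≃-sym (toℚᵘ-fromℚᵘ (ℚᵘ.mkℚᵘ (+ b) l)))
  (ℚᵘ.≤-respˡ-≃ (ℚᵘ.≃-sym (toℚᵘ-fromℚᵘ (ℚᵘ.mkℚᵘ (+ a) k)))
  (ℚᵘ.*≤* (subst₂ ℤ._≤_ (ℤ.pos-* a (suc l)) (ℤ.pos-* b (suc k)) (ℤ.+≤+ le)))))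

/-mono-< : ∀ a b k l → a ℕ.* suc l ℕ.< b ℕ.* suc k → + a / suc k < + b / suc l
/-mono-< a b k l lt = toℚᵘ-cancel-<
  (ℚᵘ.<-respʳ-≃ (ℚᵘ.≃-sym (toℚᵘ-fromℚᵘ (ℚᵘ.mkℚᵘ (+ b) l)))
  (ℚᵘ.<-respˡ-≃ (ℚᵘ.≃-sym (toℚᵘ-fromℚᵘ (ℚᵘ.mkℚᵘ (+ a) k)))
  (ℚᵘ.*<* (subst₂ ℤ._<_ (ℤ.pos-* a (suc l)) (ℤ.pos-* b (suc k)) (ℤ.+<+ lt)))))

suc/ : ∀ s l → + suc s / suc l ≡ + s / suc l + + 1 / suc l
suc/ s l = toℚᵘ-injective (begin
  toℚᵘ (+ suc s / suc l)                               ≈⟨ toℚᵘ-fromℚᵘ (ℚᵘ.mkℚᵘ (+ suc s) l) ⟩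
  ℚᵘ.mkℚᵘ (+ suc s) l                                  ≈⟨ ℚᵘ.*≡* (lemma (+ s) (+ suc l)) ⟩
  ℚᵘ.mkℚᵘ (+ s) l ℚᵘ.+ ℚᵘ.mkℚᵘ (+ 1) l                 ≈⟨ ℚᵘ.+-cong (ℚᵘ.≃-sym (toℚᵘ-fromℚᵘ (ℚᵘ.mkℚᵘ (+ s) l)))
                                                                   (ℚᵘ.≃-sym (toℚᵘ-fromℚᵘ (ℚᵘ.mkℚᵘ (+ 1) l))) ⟩
  toℚᵘ (+ s / suc l) ℚᵘ.+ toℚᵘ (+ 1 / suc l)           ≈⟨ ℚᵘ.≃-sym (toℚᵘ-homo-+ (+ s / suc l) (+ 1 / suc l)) ⟩
  toℚᵘ (+ s / suc l + + 1 / suc l)                     ∎)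
  where
  open ℚᵘ.≃-Reasoning
  lemma : ∀ a b → (+ 1 ℤ.+ a) ℤ.* (b ℤ.* b) ≡ (a ℤ.* b ℤ.+ + 1 ℤ.* b) ℤ.* b
  lemma = solve 2 (λ a b → (con (+ 1) :+ a) :* (b :* b) := (a :* b :+ con (+ 1) :* b) :* b) refl
    where open ℤ-Solver

archimedean : ∀ ε → 0ℚ < ε → ∃ λ N → ∀ n → N ℕ.≤ n → + 1 / suc n < ε
archimedean ε@(mkℚ (+ suc p) q _) _ = suc q , λ n q<n →
  subst (+ 1 / suc n <_) (↥p/↧p≡p ε)
    (/-mono-< 1 (suc p) n q
      (ℕ.≤-trans (ℕ.s≤s (ℕ.≤-trans (ℕ.≤-reflexive (ℕ.*-identityˡ (suc q))) q<n))
                 (ℕ.m≤m+n (suc n) (p ℕ.* suc n))))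
archimedean (mkℚ (+ zero) _ _) (*<* (ℤ.+<+ ()))
archimedean (mkℚ (ℤ.-[1+ _ ]) _ _) (*<* ())

infix 9 √_ 1/√_

-- k-th term: the largest multiple of 1/(k+1) not exceeding √n
√-seq : ℕ → ℕ → ℚ
√-seq n k = + ⌊√ n ℕ.* (suc k ℕ.* suc k) ⌋ / suc k

√-seq-step : ∀ n k l → √-seq n k - √-seq n l ≤ + 1 / suc l
√-seq-step n k l = begin
  √-seq n k - √-seq n l                      ≤⟨ +-monoˡ-≤ (- √-seq n l) (/-mono-≤ r (suc s) k l (ℕ.<⇒≤ r<s)) ⟩
  + suc s / suc l - √-seq n l                ≡⟨ cong (_- √-seq n l) (suc/ s l) ⟩
  (√-seq n l + + 1 / suc l) - √-seq n l      ≡⟨ lemma (√-seq n l) (+ 1 / suc l) ⟩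
  + 1 / suc l                                ∎
  where
  r = ⌊√ n ℕ.* (suc k ℕ.* suc k) ⌋
  s = ⌊√ n ℕ.* (suc l ℕ.* suc l) ⌋
  lemma : ∀ p q → (p + q) - p ≡ q
  lemma = solve 2 (λ p q → (p :+ q) :- p := q) refl
    where open +-*-Solver
  swap : ∀ a b → (a ℕ.* b) ℕ.* (a ℕ.* b) ≡ (a ℕ.* a) ℕ.* (b ℕ.* b)
  swap a b = ℕ.[m*n]*[o*p]≡[m*o]*[n*p] a b a b
  K = suc k ℕ.* suc k
  L = suc l ℕ.* suc l
  square-< : (r ℕ.* suc l) ℕ.* (r ℕ.* suc l) ℕ.< (suc s ℕ.* suc k) ℕ.* (suc s ℕ.* suc k)
  square-< = begin-strict
    (r ℕ.* suc l) ℕ.* (r ℕ.* suc l)           ≡⟨ swap r (suc l) ⟩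
    (r ℕ.* r) ℕ.* L                           ≤⟨ ℕ.*-monoˡ-≤ L (⌊√⌋-lower (n ℕ.* K)) ⟩
    (n ℕ.* K) ℕ.* L                           ≡⟨ ℕ.*-assoc n K L ⟩
    n ℕ.* (K ℕ.* L)                           ≡⟨ cong (n ℕ.*_) (ℕ.*-comm K L) ⟩
    n ℕ.* (L ℕ.* K)                           ≡⟨ sym (ℕ.*-assoc n L K) ⟩
    (n ℕ.* L) ℕ.* K                           <⟨ ℕ.*-monoˡ-< K (⌊√⌋-upper (n ℕ.* L)) ⟩
    (suc s ℕ.* suc s) ℕ.* K                   ≡⟨ sym (swap (suc s) (suc k)) ⟩
    (suc s ℕ.* suc k) ℕ.* (suc s ℕ.* suc k)   ∎
    where open ℕ.≤-Reasoning
  r<s : r ℕ.* suc l ℕ.< suc s ℕ.* suc k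
  r<s = square-cancel-< square-<
  open ≤-Reasoning

√_ : ℕ → ℝ
√ n = mkℝ (√-seq n) λ ε ε>0 →
  let (N , small) = archimedean ε ε>0
  in N , λ k l N≤k N≤l → bound k l (small k N≤k) (small l N≤l)
  where
  bound : ∀ {ε} k l → + 1 / suc k < ε → + 1 / suc l < ε → ∣ √-seq n k - √-seq n l ∣ < ε
  bound {ε} k l k-small l-small with ∣p∣≡p∨∣p∣≡-p (√-seq n k - √-seq n l)
  ... | inj₁ e = subst (_< ε) (sym e) (≤-<-trans (√-seq-step n k l) l-small)
  ... | inj₂ e = subst (_< ε) (sym (trans e (neg-minus (√-seq n k) (√-seq n l))))
                   (≤-<-trans (√-seq-step n l k) k-small)

√-apart₀ : ∀ n → Apart₀ (√ suc n)
√-apart₀ n = 1ℚ , positive⁻¹ 1ℚ , 0 , λ k _ →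
  ≤-trans (1≤√ k) (p≤∣p∣ (√-seq (suc n) k))
  where
  1≤√ : ∀ k → 1ℚ ≤ √-seq (suc n) k
  1≤√ k = /-mono-≤ 1 r 0 k
    (subst₂ ℕ._≤_ (sym (ℕ.*-identityˡ (suc k))) (sym (ℕ.*-identityʳ r))
      (ℕ.s≤s⁻¹ (square-cancel-<
        (ℕ.≤-<-trans (ℕ.m≤m+n K (n ℕ.* K)) (⌊√⌋-upper (suc n ℕ.* K))))))
    where
    K = suc k ℕ.* suc k
    r = ⌊√ suc n ℕ.* K ⌋
  p≤∣p∣ : ∀ p → p ≤ ∣ p ∣
  p≤∣p∣ p with ≤-total 0ℚ p
  ... | inj₁ 0≤p = ≤-reflexive (sym (0≤p⇒∣p∣≡p 0≤p))
  ... | inj₂ p≤0 = ≤-trans p≤0 (0≤∣p∣ p)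

-- The value at 0 is never used below: adjacent vertices have positive degree.
1/√_ : ℕ → ℝ
1/√ zero  = fromℚ 0ℚ
1/√ suc n = (√ suc n) ⁻¹[ √-apart₀ n ]

module _ {c ℓ} (R : RawRing c ℓ) where
  open RawRing R using (Carrier; _≈_; 0#; 1#)
    renaming (_+_ to _⊕_; _*_ to _⊛_; -_ to ⊖_)
  open RawMonoidDefs (RawRing.+-rawMonoid R) using (sum)
  open RawMonoidDefs (RawRing.*-rawMonoid R) using () renaming (sum to product)
  open RawSemiringDefs (RawRing.rawSemiring R) using (_^_)

  Matrix : ℕ → Set c
  Matrix n = Vector (Vector Carrier n) n

  -- Laplace expansion along the first row
  det : ∀ {n} → Matrix n → Carrier
  det {zero}  M = 1#
  det {suc n} M = sum λ j →
    (⊖ 1#) ^ toℕ j ⊛ M zero j ⊛ det (λ i k → M (suc i) (punchIn j k))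

  identity : ∀ {n} → Matrix n
  identity i j = if does (i Fin.≟ j) then 1# else 0#

  charPoly : ∀ {n} → Matrix n → Carrier → Carrier
  charPoly M x = det λ i j → x ⊛ identity i j ⊕ (⊖ M i j)

  -- ρ lists the roots of the characteristic polynomial with multiplicity.
  -- Equality of polynomials is expressed by equality of values, so this
  -- is only meaningful over an infinite integral domain such as ℝ.
  AreEigenvalues : ∀ {n} → Matrix n → Vector Carrier n → Set (c ⊔ˡ ℓ)
  AreEigenvalues M ρ = ∀ x → charPoly M x ≈ product λ i → x ⊕ (⊖ ρ i)

record SimpleGraph : Set where
  field
    order  : ℕ
    adj    : Fin order → Fin order → Bool
    symm   : ∀ i j → adj i j ≡ adj j i
    irrefl : ∀ i → adj i i ≡ false

  neighbours : Fin order → Subset order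
  neighbours i = tabulate (adj i)

  degree : Fin order → ℕ
  degree i = Subset.∣ neighbours i ∣

module _ (G : SimpleGraph) where
  open SimpleGraph G
  open RawMonoidDefs (RawRing.+-rawMonoid ℝ-rawRing) using (sum)

  randićMatrix : Matrix ℝ-rawRing order
  randićMatrix i j = if adj i j then 1/√ (degree i ℕ.* degree j) else fromℚ 0ℚ

  -- The eigenvalues are determined only up to order, and the energy only
  -- up to _≃ᴿ_, so RE(G) = r is expressed as a relation.
  RandićEnergyIs : ℝ → Set
  RandićEnergyIs r = Σ (Vector ℝ order) λ ρ →
    AreEigenvalues ℝ-rawRing randićMatrix ρ × sum (λ i → ∣ ρ i ∣ᴿ) ≃ᴿ r

{-# OPTIONS --safe #-}

-- Adding a disjoint edge to a graph adds the eigenvalues 1 and -1 to its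
-- Randić spectrum, hence 2 to its energy.  Even energies are thus reached from
-- the empty graph, and odd ones from the path on four vertices, whose Randić
-- eigenvalues are 1, -1, 1/2 and -1/2.

module Submission where

open import Algebra.Bundles using (CommutativeRing)
open import Algebra.Bundles.Raw using (RawRing)
open import Algebra.Core using (Op₁; Op₂)
import Algebra.Definitions.RawMonoid as RawMonoidDefs
import Algebra.Properties.Monoid.Sum as MonoidSum
import Algebra.Solver.Ring
open import Algebra.Solver.Ring.AlmostCommutativeRing
  using (fromCommutativeRing; _-Raw-AlmostCommutative⟶_)
open import Algebra.Structures using (IsCommutativeRing)
open import Data.Bool using (Bool; true; false; _∨_; if_then_else_)
open import Data.Bool.Properties using (∨-comm)
open import Data.Fin using (Fin; zero; suc; toℕ; punchIn)
import Data.Fin.Subset as Subset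
open import Data.Integer using (+_)
import Data.Integer as ℤ
import Data.Integer.Properties as ℤ
open import Data.Maybe using (Maybe; just; nothing)
open import Data.Nat as ℕ using (ℕ; zero; suc; _≤_; _≡ᵇ_)
import Data.Nat.Properties as ℕ
open import Data.Product using (Σ; _,_)
open import Data.Rational as ℚ using (ℚ; 0ℚ; 1ℚ; ½; _/_; ∣_∣)
import Data.Rational.Properties as ℚ
open import Data.Rational.Solver using () renaming (module +-*-Solver to ℚ-Solver)
import Data.Rational.Unnormalised as ℚᵘ
import Data.Rational.Unnormalised.Properties as ℚᵘ
open import Data.Vec using (tabulate)
open import Data.Vec.Functional using (Vector; []; _∷_)
open import Level using (0ℓ; _⊔_)
open import Relation.Binary.Core using (Rel)
open import Relation.Binary.PropositionalEquality
  using (_≡_; _≢_; refl; sym; trans; cong; cong₂; subst)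
open import Relation.Nullary using (yes; no)

open import Defs

-- Determinants of matrices with a corner block

module Determinant {c ℓ} (R : CommutativeRing c ℓ) where
  open CommutativeRing R hiding (zero) renaming (refl to ≈-refl; sym to ≈-sym; trans to ≈-trans)
  open import Algebra.Properties.Ring ring using (-‿distribˡ-*; -1*x≈-x)
  open RawMonoidDefs (RawRing.+-rawMonoid rawRing) using (sum)
  open MonoidSum +-monoid using (sum-cong-≋; sum-replicate-zero)
  open import Algebra.Properties.Semiring.Exp semiring using (_^_)
  open import Relation.Binary.Reasoning.Setoid setoid

  private
    D : ∀ {n} → Matrix rawRing n → Carrier
    D = det rawRing

  sum≈0 : ∀ {n} (v : Vector Carrier n) → (∀ i → v i ≈ 0#) → sum v ≈ 0#
  sum≈0 {n} v v≈0 = ≈-trans (sum-cong-≋ v≈0) (sum-replicate-zero n)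

  laplaceTerm : ∀ {n} → Matrix rawRing (suc n) → Vector Carrier (suc n)
  laplaceTerm M j = (- 1#) ^ toℕ j * M zero j * D (λ i k → M (suc i) (punchIn j k))

  laplaceTerm≈0 : ∀ {n} (M : Matrix rawRing (suc n)) j → M zero j ≈ 0# → laplaceTerm M j ≈ 0#
  laplaceTerm≈0 M j Mj≈0 =
    ≈-trans (*-congʳ (≈-trans (*-congˡ Mj≈0) (zeroʳ _))) (zeroˡ _)

  det-cornerRow : ∀ {n} (M : Matrix rawRing (suc n)) → (∀ j → M zero (suc j) ≈ 0#) →
    D M ≈ M zero zero * D (λ i j → M (suc i) (suc j))
  det-cornerRow M row≈0 = begin
    1# * a * e + sum tail  ≈⟨ +-cong (*-congʳ (*-identityˡ a))
                                (sum≈0 tail λ j → laplaceTerm≈0 M (suc j) (row≈0 j)) ⟩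
    a * e + 0#             ≈⟨ +-identityʳ (a * e) ⟩
    a * e                  ∎
    where
    a = M zero zero
    e = D λ i j → M (suc i) (suc j)
    tail = λ j → laplaceTerm M (suc j)

  -- Only two Laplace terms survive. Each of their minors again has a first row supported in its
  -- corner, and expanding both leaves the same complementary minor, which factors out of the 2 by 2
  -- determinant.
  det-cornerBlock : ∀ {n} (M : Matrix rawRing (suc (suc n))) →
    (∀ j → M zero (suc (suc j)) ≈ 0#) → (∀ j → M (suc zero) (suc (suc j)) ≈ 0#) →
    D M ≈ (M zero zero * M (suc zero) (suc zero) + - (M zero (suc zero) * M (suc zero) zero))
            * D (λ i j → M (suc (suc i)) (suc (suc j)))
  det-cornerBlock M row₀≈0 row₁≈0 = begin
    1# * a * D M₀₀ + (- 1# * 1# * b * D M₀₁ + sum tail)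
      ≈⟨ +-cong (*-congʳ (*-identityˡ a))
           (+-cong (*-congʳ (*-congʳ (*-identityʳ (- 1#))))
             (sum≈0 tail λ j → laplaceTerm≈0 M (suc (suc j)) (row₀≈0 j))) ⟩
    a * D M₀₀ + (- 1# * b * D M₀₁ + 0#)
      ≈⟨ +-cong (*-congˡ (det-cornerRow M₀₀ row₁≈0))
           (≈-trans (+-identityʳ _) (*-cong (-1*x≈-x b) (det-cornerRow M₀₁ row₁≈0))) ⟩
    a * (d * e) + - b * (c′ * e)
      ≈⟨ +-cong (*-assoc a d e) (*-assoc (- b) c′ e) ⟨
    a * d * e + - b * c′ * e
      ≈⟨ +-congˡ (*-congʳ (-‿distribˡ-* b c′)) ⟨
    a * d * e + - (b * c′) * e
      ≈⟨ distribʳ e (a * d) (- (b * c′)) ⟨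
    (a * d + - (b * c′)) * e ∎
    where
    a = M zero zero
    b = M zero (suc zero)
    c′ = M (suc zero) zero
    d = M (suc zero) (suc zero)
    e = D λ i j → M (suc (suc i)) (suc (suc j))
    M₀₀ M₀₁ : Matrix rawRing (suc _)
    M₀₀ i k = M (suc i) (suc k)
    -- `punchIn (suc zero)` fixes `zero` and shifts every later index by one. The corner of `M₀₁` is
    -- therefore `c′`, and its complementary minor is `e` by computation.
    M₀₁ i k = M (suc i) (punchIn (suc zero) k)
    tail = λ j → laplaceTerm M (suc (suc j))

-- Graphs

∣tabulate-false∣≡0 : ∀ n → Subset.∣ tabulate {n = n} (λ _ → false) ∣ ≡ 0
∣tabulate-false∣≡0 zero    = refl
∣tabulate-false∣≡0 (suc n) = ∣tabulate-false∣≡0 n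

emptyGraph : SimpleGraph
emptyGraph = record { order = 0 ; adj = λ () ; symm = λ () ; irrefl = λ () }

module _ (G : SimpleGraph) where
  open SimpleGraph G

  -- The new vertices are numbered first, which puts their block in the corner where
  -- `det-cornerBlock` splits it off.
  addEdge : SimpleGraph
  addEdge = record
    { order = suc (suc order) ; adj = adj⁺ ; symm = symm⁺ ; irrefl = irrefl⁺ }
    where
    adj⁺ : Fin (suc (suc order)) → Fin (suc (suc order)) → Bool
    adj⁺ zero          (suc zero)    = true
    adj⁺ (suc zero)    zero          = true
    adj⁺ (suc (suc i)) (suc (suc j)) = adj i j
    adj⁺ zero          zero          = false
    adj⁺ zero          (suc (suc _)) = false
    adj⁺ (suc zero)    (suc _)       = false
    adj⁺ (suc (suc _)) zero          = false
    adj⁺ (suc (suc _)) (suc zero)    = false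
    symm⁺ : ∀ i j → adj⁺ i j ≡ adj⁺ j i
    symm⁺ zero          zero          = refl
    symm⁺ zero          (suc zero)    = refl
    symm⁺ zero          (suc (suc _)) = refl
    symm⁺ (suc zero)    zero          = refl
    symm⁺ (suc zero)    (suc zero)    = refl
    symm⁺ (suc zero)    (suc (suc _)) = refl
    symm⁺ (suc (suc _)) zero          = refl
    symm⁺ (suc (suc _)) (suc zero)    = refl
    symm⁺ (suc (suc i)) (suc (suc j)) = symm i j
    irrefl⁺ : ∀ i → adj⁺ i i ≡ false
    irrefl⁺ zero          = refl
    irrefl⁺ (suc zero)    = refl
    irrefl⁺ (suc (suc i)) = irrefl i

path₄ : SimpleGraph
path₄ = record
  { order  = 4
  ; adj    = λ i j → (suc (toℕ i) ≡ᵇ toℕ j) ∨ (suc (toℕ j) ≡ᵇ toℕ i)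
  ; symm   = λ i j → ∨-comm (suc (toℕ i) ≡ᵇ toℕ j) (suc (toℕ j) ≡ᵇ toℕ i)
  ; irrefl = λ { zero → refl ; (suc zero) → refl ; (suc (suc zero)) → refl
               ; (suc (suc (suc zero))) → refl }
  }

-- Spectra over an abstract ring

-- randićMatrix with 1/√_ replaced by an arbitrary function, so that its
-- characteristic polynomial can be computed in an abstract ring.
weightedAdjacency : ∀ {c ℓ} (R : RawRing c ℓ) G → (ℕ → RawRing.Carrier R) →
  Matrix R (SimpleGraph.order G)
weightedAdjacency R G w i j = if adj i j then w (degree i ℕ.* degree j) else 0#
  where
  open RawRing R using (0#)
  open SimpleGraph G

-- A record, unlike AreEigenvalues itself, is compared parameter by parameter,
-- without unfolding the characteristic polynomials.
record Spectrum {c ℓ} (R : RawRing c ℓ) {n} (M : Matrix R n) (ρ : Vector (RawRing.Carrier R) n) :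
  Set (c ⊔ ℓ) where
  constructor spectrum
  field
    areEigenvalues : AreEigenvalues R M ρ

-- A commutative ring with a ring homomorphism φ from ℚ, whose zero and unit
-- are φ 0 and φ 1 by definition: determinants of matrices of solver polynomials
-- then evaluate definitionally to determinants over the ring.
module ℚ-Algebra {c ℓ} {A : Set c} {_≃_ : Rel A ℓ} {_⊕_ _⊗_ : Op₂ A} {⊖_ : Op₁ A} (φ : ℚ → A)
  (isCommutativeRing : IsCommutativeRing _≃_ _⊕_ _⊗_ ⊖_ (φ 0ℚ) (φ 1ℚ))
  (+-homo : ∀ p q → φ (p ℚ.+ q) ≃ (φ p ⊕ φ q))
  (*-homo : ∀ p q → φ (p ℚ.* q) ≃ (φ p ⊗ φ q))
  (-‿homo : ∀ p → φ (ℚ.- p) ≃ (⊖ φ p))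
  where

  ring : CommutativeRing c ℓ
  ring = record { isCommutativeRing = isCommutativeRing }

  open CommutativeRing ring
    using ( _≈_; _+_; _*_; -_; rawRing; setoid; reflexive
          ; +-cong; +-congˡ; *-cong; *-congˡ; *-congʳ; -‿cong)
    renaming (refl to ≈-refl)
  open import Relation.Binary.Reasoning.Setoid setoid

  φ-≟ : ∀ p q → Maybe (φ p ≈ φ q)
  φ-≟ p q with p ℚ.≟ q
  ... | yes p≡q = just (reflexive (cong φ p≡q))
  ... | no  _   = nothing

  φ-morphism : ℚ.+-*-rawRing -Raw-AlmostCommutative⟶ fromCommutativeRing ring
  φ-morphism = record
    { ⟦_⟧    = φ
    ; +-homo = +-homo
    ; *-homo = *-homo
    ; -‿homo = -‿homo
    ; 0-homo = ≈-refl
    ; 1-homo = ≈-refl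
    }

  open Algebra.Solver.Ring ℚ.+-*-rawRing (fromCommutativeRing ring) φ-morphism φ-≟
    using (Polynomial; solve; _:=_; con; _:+_; _:*_; :-_)

  -- Solver expressions form a raw ring, so `charPoly` itself can produce the solver's input and no
  -- determinant has to be expanded by hand.
  polynomialRing : ℕ → RawRing 0ℓ 0ℓ
  polynomialRing n = record
    { Carrier = Polynomial n
    ; _≈_ = _≡_
    ; _+_ = _:+_
    ; _*_ = _:*_
    ; -_ = :-_
    ; 0# = con 0ℚ
    ; 1# = con 1ℚ
    }

  -- Multiply `r * r` by `m * q` and write `m` as `s * s`: the result regroups as the square of
  -- `s * r` times `q`. With `s` a square root of `m`, this gives the square of an inverse square
  -- root.
  inverse-square : ∀ {s r m q} → s * s ≈ m → s * r ≈ φ 1ℚ → m * q ≈ φ 1ℚ → r * r ≈ q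
  inverse-square {s} {r} {m} {q} s²≈m sr≈1 mq≈1 = begin
    r * r                      ≈⟨ solve 1 (λ r → r :* r := r :* r :* con 1ℚ) ≈-refl r ⟩
    r * r * φ 1ℚ               ≈⟨ *-congˡ mq≈1 ⟨
    r * r * (m * q)            ≈⟨ *-congˡ (*-congʳ s²≈m) ⟨
    r * r * (s * s * q)        ≈⟨ solve 3 (λ r s q → r :* r :* (s :* s :* q) := s :* r :* (s :* r) :* q)
                                    ≈-refl r s q ⟩
    s * r * (s * r) * q        ≈⟨ *-congʳ (*-cong sr≈1 sr≈1) ⟩
    φ 1ℚ * φ 1ℚ * q            ≈⟨ solve 1 (λ q → con 1ℚ :* con 1ℚ :* q := q) ≈-refl q ⟩
    q                          ∎

  module _ (w : ℕ → A) where

    -- The corner block has determinant x² - 1 = (x - 1)(x + 1), and the complementary minor is the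
    -- characteristic polynomial for `G`.
    addEdge-spectrum : ∀ G {ρ : Vector A (SimpleGraph.order G)} → w 1 * w 1 ≈ φ 1ℚ →
      Spectrum rawRing (weightedAdjacency rawRing G w) ρ →
      Spectrum rawRing (weightedAdjacency rawRing (addEdge G) w) (φ 1ℚ ∷ φ (ℚ.- 1ℚ) ∷ ρ)
    addEdge-spectrum G {ρ} w₁²≈1 (spectrum isEig) = spectrum λ x →
      let p = charPoly rawRing (weightedAdjacency rawRing G w) x
          q = product λ i → x + - ρ i
      in begin
      charPoly rawRing (weightedAdjacency rawRing (addEdge G) w) x
        -- Degrees of old vertices and the entries of `identity` reduce to those for `G`, so the
        -- complementary minor is `p` by computation.
        ≈⟨ Determinant.det-cornerBlock ring
             (λ i j → x * identity rawRing i j + - weightedAdjacency rawRing (addEdge G) w i j)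
             (λ _ → off≈0 x) (λ _ → off≈0 x) ⟩
      ((x * φ 1ℚ + - φ 0ℚ) * (x * φ 1ℚ + - φ 0ℚ) + - ((x * φ 0ℚ + - w d) * (x * φ 0ℚ + - w d))) * p
        ≈⟨ solve 3 (λ x e p →
             ((x :* con 1ℚ :+ :- con 0ℚ) :* (x :* con 1ℚ :+ :- con 0ℚ)
               :+ :- ((x :* con 0ℚ :+ :- e) :* (x :* con 0ℚ :+ :- e))) :* p
             := (x :* x :+ :- (e :* e)) :* p) ≈-refl x (w d) p ⟩
      (x * x + - (w d * w d)) * p
        ≈⟨ *-cong (+-congˡ (-‿cong w[d]²≈1)) (isEig x) ⟩
      (x * x + - φ 1ℚ) * q
        ≈⟨ solve 2 (λ x q → (x :* x :+ :- con 1ℚ) :* q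
             := (x :+ :- con 1ℚ) :* ((x :+ :- con (ℚ.- 1ℚ)) :* q)) ≈-refl x q ⟩
      (x + - φ 1ℚ) * ((x + - φ (ℚ.- 1ℚ)) * q) ∎
      where
      open SimpleGraph G using (order)
      open RawMonoidDefs (RawRing.*-rawMonoid rawRing) using () renaming (sum to product)
      d = SimpleGraph.degree (addEdge G) zero ℕ.* SimpleGraph.degree (addEdge G) (suc zero)
      off≈0 : ∀ x → x * φ 0ℚ + - φ 0ℚ ≈ φ 0ℚ
      off≈0 = solve 1 (λ x → x :* con 0ℚ :+ :- con 0ℚ := con 0ℚ) ≈-refl
      w[d]²≈1 : w d * w d ≈ φ 1ℚ
      -- Both endpoints have degree one plus the count of an all-false vector of length `order`.
      -- That count is stuck on the variable `order`, so its value 0 is substituted.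
      w[d]²≈1 = subst (λ z → w (suc z ℕ.* suc z) * w (suc z ℕ.* suc z) ≈ φ 1ℚ)
        (sym (∣tabulate-false∣≡0 order)) w₁²≈1

    -- The degrees of the endpoints multiply to 2 for the outer edges and to 4
    -- for the middle one.
    path₄-spectrum : w 2 * w 2 ≈ φ ½ → w 4 * w 4 ≈ φ (½ ℚ.* ½) →
      Spectrum rawRing (weightedAdjacency rawRing path₄ w)
        (φ 1ℚ ∷ φ (ℚ.- 1ℚ) ∷ φ ½ ∷ φ (ℚ.- ½) ∷ [])
    path₄-spectrum w₂²≈½ w₄²≈¼ = spectrum λ x → begin
      charPoly rawRing (weightedAdjacency rawRing path₄ w) x
        -- Every edge has degree product 2 or 4, so the `else` branch stands for the weight at 4.
        ≈⟨ solve 3 (λ x a b →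
             charPoly (polynomialRing 3)
               (weightedAdjacency (polynomialRing 3) path₄ λ d → if d ≡ᵇ 2 then a else b) x
             := quartic x (a :* a) (b :* b)) ≈-refl x (w 2) (w 4) ⟩
      x * x * (x * x) + - ((w 2 * w 2 + w 2 * w 2 + w 4 * w 4) * (x * x)) + w 2 * w 2 * (w 2 * w 2)
        ≈⟨ +-cong (+-congˡ (-‿cong (*-congʳ (+-cong (+-cong w₂²≈½ w₂²≈½) w₄²≈¼)))) (*-cong w₂²≈½ w₂²≈½) ⟩
      x * x * (x * x) + - ((φ ½ + φ ½ + φ (½ ℚ.* ½)) * (x * x)) + φ ½ * φ ½
        ≈⟨ solve 1 (λ x → quartic x (con ½) (con (½ ℚ.* ½))
             := (x :+ :- con 1ℚ) :* ((x :+ :- con (ℚ.- 1ℚ)) :*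
                  ((x :+ :- con ½) :* ((x :+ :- con (ℚ.- ½)) :* con 1ℚ)))) ≈-refl x ⟩
      (x + - φ 1ℚ) * ((x + - φ (ℚ.- 1ℚ)) * ((x + - φ ½) * ((x + - φ (ℚ.- ½)) * φ 1ℚ))) ∎
      where
      -- The weighted matching polynomial of the path, with `u` and `v` the squared weights of the
      -- outer and middle edges. At 1/2 and 1/4 it becomes (x² - 1)(x² - 1/4).
      quartic : ∀ {n} → Polynomial n → Polynomial n → Polynomial n → Polynomial n
      quartic x u v = x :* x :* (x :* x) :+ :- ((u :+ u :+ v) :* (x :* x)) :+ u :* u

-- The ring of real numbers

≗⇒≃ᴿ : ∀ {x y} → (∀ n → seq x n ≡ seq y n) → x ≃ᴿ y
≗⇒≃ᴿ {x} {y} x≗y ε ε>0 = 0 , λ n _ →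
  subst (λ z → ∣ z ∣ ℚ.< ε)
    (sym (trans (cong (ℚ._- seq y n) (x≗y n)) (ℚ.+-inverseʳ (seq y n)))) ε>0

≃ᴿ-refl : ∀ {x} → x ≃ᴿ x
≃ᴿ-refl {x} = ≗⇒≃ᴿ {x} {x} λ _ → refl

≃ᴿ-sym : ∀ {x y} → x ≃ᴿ y → y ≃ᴿ x
≃ᴿ-sym {x} {y} x≃y ε ε>0 =
  let (N , close) = x≃y ε ε>0
  in N , λ n N≤n → subst (ℚ._< ε) (∣-∣-sym (seq x n) (seq y n)) (close n N≤n)

≃ᴿ-trans : ∀ {x y z} → x ≃ᴿ y → y ≃ᴿ z → x ≃ᴿ z
≃ᴿ-trans {x} {y} {z} x≃y y≃z ε ε>0 =
  let (M , xy-close) = x≃y (½ ℚ.* ε) (half>0 ε>0)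
      (N , yz-close) = y≃z (½ ℚ.* ε) (half>0 ε>0)
  in M ℕ.⊔ N , λ n ≤n →
    let a = seq x n; b = seq y n; c = seq z n in
    begin-strict
      ∣ a ℚ.- c ∣                      ≡⟨ cong ∣_∣ (lemma a b c) ⟩
      ∣ (a ℚ.- b) ℚ.+ (b ℚ.- c) ∣      ≤⟨ ℚ.∣p+q∣≤∣p∣+∣q∣ (a ℚ.- b) (b ℚ.- c) ⟩
      ∣ a ℚ.- b ∣ ℚ.+ ∣ b ℚ.- c ∣      <⟨ ℚ.+-mono-< (xy-close n (ℕ.m⊔n≤o⇒m≤o M N ≤n))
                                                     (yz-close n (ℕ.m⊔n≤o⇒n≤o M N ≤n)) ⟩
      ½ ℚ.* ε ℚ.+ ½ ℚ.* ε              ≡⟨ half+half ε ⟩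
      ε                                ∎
  where
  open ℚ.≤-Reasoning
  lemma : ∀ a b c → a ℚ.- c ≡ (a ℚ.- b) ℚ.+ (b ℚ.- c)
  lemma = solve 3 (λ a b c → a :- c := (a :- b) :+ (b :- c)) refl
    where open ℚ-Solver

+ᴿ-cong : ∀ {x x′ y y′} → x ≃ᴿ x′ → y ≃ᴿ y′ → x +ᴿ y ≃ᴿ x′ +ᴿ y′
+ᴿ-cong {x} {x′} {y} {y′} x≃x′ y≃y′ ε ε>0 =
  let (M , x-close) = x≃x′ (½ ℚ.* ε) (half>0 ε>0)
      (N , y-close) = y≃y′ (½ ℚ.* ε) (half>0 ε>0)
  in M ℕ.⊔ N , λ n ≤n →
    let a = seq x n; b = seq x′ n; c = seq y n; d = seq y′ n in
    begin-strict
      ∣ (a ℚ.+ c) ℚ.- (b ℚ.+ d) ∣      ≡⟨ cong ∣_∣ (lemma a b c d) ⟩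
      ∣ (a ℚ.- b) ℚ.+ (c ℚ.- d) ∣      ≤⟨ ℚ.∣p+q∣≤∣p∣+∣q∣ (a ℚ.- b) (c ℚ.- d) ⟩
      ∣ a ℚ.- b ∣ ℚ.+ ∣ c ℚ.- d ∣      <⟨ ℚ.+-mono-< (x-close n (ℕ.m⊔n≤o⇒m≤o M N ≤n))
                                                     (y-close n (ℕ.m⊔n≤o⇒n≤o M N ≤n)) ⟩
      ½ ℚ.* ε ℚ.+ ½ ℚ.* ε              ≡⟨ half+half ε ⟩
      ε                                ∎
  where
  open ℚ.≤-Reasoning
  lemma : ∀ a b c d → (a ℚ.+ c) ℚ.- (b ℚ.+ d) ≡ (a ℚ.- b) ℚ.+ (c ℚ.- d)
  lemma = solve 4 (λ a b c d → (a :+ c) :- (b :+ d) := (a :- b) :+ (c :- d)) refl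
    where open ℚ-Solver

-ᴿ-cong : ∀ {x y} → x ≃ᴿ y → -ᴿ x ≃ᴿ -ᴿ y
-ᴿ-cong {x} {y} x≃y ε ε>0 =
  let (N , close) = x≃y ε ε>0
  in N , λ n N≤n → subst (ℚ._< ε)
    (trans (∣-∣-sym (seq x n) (seq y n)) (cong ∣_∣ (lemma (seq x n) (seq y n))))
    (close n N≤n)
  where
  lemma : ∀ a b → b ℚ.- a ≡ ℚ.- a ℚ.- ℚ.- b
  lemma = solve 2 (λ a b → b :- a := :- a :- :- b) refl
    where open ℚ-Solver

scaled : ∀ p r q → p ℚ.* r ≡ 1ℚ → p ℚ.* (r ℚ.* q) ≡ q
scaled p r q pr≡1 =
  trans (sym (ℚ.*-assoc p r q)) (trans (cong (ℚ._* q) pr≡1) (ℚ.*-identityˡ q))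

-- Uses ac - bd = a(c - d) + d(a - b). The multipliers a and d are terms of `x` and `y′`, hence
-- these two sequences are bounded, and each tolerance is divided by the bound that will multiply
-- it.
*ᴿ-cong : ∀ {x x′ y y′} → x ≃ᴿ x′ → y ≃ᴿ y′ → x *ᴿ y ≃ᴿ x′ *ᴿ y′
*ᴿ-cong {x} {x′} {y} {y′} x≃x′ y≃y′ ε ε>0 =
  let (B , B>0 , K , x≤B) = eventually-bounded x
      (C , C>0 , L , y′≤C) = eventually-bounded y′
      (B⁻¹ , B⁻¹>0 , BB⁻¹≡1) = 1/>0 B>0
      (C⁻¹ , C⁻¹>0 , CC⁻¹≡1) = 1/>0 C>0
      (M , x-close) = x≃x′ (C⁻¹ ℚ.* (½ ℚ.* ε)) (*>0 C⁻¹>0 (half>0 ε>0))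
      (N , y-close) = y≃y′ (B⁻¹ ℚ.* (½ ℚ.* ε)) (*>0 B⁻¹>0 (half>0 ε>0))
  in (K ℕ.⊔ L) ℕ.⊔ (M ℕ.⊔ N) , λ n ≤n →
    let a = seq x n; b = seq x′ n; c = seq y n; d = seq y′ n
        KL≤n = ℕ.m⊔n≤o⇒m≤o (K ℕ.⊔ L) (M ℕ.⊔ N) ≤n
        MN≤n = ℕ.m⊔n≤o⇒n≤o (K ℕ.⊔ L) (M ℕ.⊔ N) ≤n
    in begin-strict
      ∣ a ℚ.* c ℚ.- b ℚ.* d ∣
        ≡⟨ cong ∣_∣ (lemma a b c d) ⟩
      ∣ a ℚ.* (c ℚ.- d) ℚ.+ d ℚ.* (a ℚ.- b) ∣
        ≤⟨ ℚ.∣p+q∣≤∣p∣+∣q∣ (a ℚ.* (c ℚ.- d)) (d ℚ.* (a ℚ.- b)) ⟩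
      ∣ a ℚ.* (c ℚ.- d) ∣ ℚ.+ ∣ d ℚ.* (a ℚ.- b) ∣
        ≡⟨ cong₂ ℚ._+_ (ℚ.∣p*q∣≡∣p∣*∣q∣ a (c ℚ.- d)) (ℚ.∣p*q∣≡∣p∣*∣q∣ d (a ℚ.- b)) ⟩
      ∣ a ∣ ℚ.* ∣ c ℚ.- d ∣ ℚ.+ ∣ d ∣ ℚ.* ∣ a ℚ.- b ∣
        ≤⟨ ℚ.+-mono-≤
             (ℚ.*-monoʳ-≤-nonNeg ∣ c ℚ.- d ∣ {{ℚ.∣-∣-nonNeg (c ℚ.- d)}} (x≤B n (ℕ.m⊔n≤o⇒m≤o K L KL≤n)))
             (ℚ.*-monoʳ-≤-nonNeg ∣ a ℚ.- b ∣ {{ℚ.∣-∣-nonNeg (a ℚ.- b)}} (y′≤C n (ℕ.m⊔n≤o⇒n≤o K L KL≤n))) ⟩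
      B ℚ.* ∣ c ℚ.- d ∣ ℚ.+ C ℚ.* ∣ a ℚ.- b ∣
        <⟨ ℚ.+-mono-<
             (ℚ.*-monoʳ-<-pos B {{ℚ.positive B>0}} (y-close n (ℕ.m⊔n≤o⇒n≤o M N MN≤n)))
             (ℚ.*-monoʳ-<-pos C {{ℚ.positive C>0}} (x-close n (ℕ.m⊔n≤o⇒m≤o M N MN≤n))) ⟩
      B ℚ.* (B⁻¹ ℚ.* (½ ℚ.* ε)) ℚ.+ C ℚ.* (C⁻¹ ℚ.* (½ ℚ.* ε))
        ≡⟨ cong₂ ℚ._+_ (scaled B B⁻¹ (½ ℚ.* ε) BB⁻¹≡1) (scaled C C⁻¹ (½ ℚ.* ε) CC⁻¹≡1) ⟩
      ½ ℚ.* ε ℚ.+ ½ ℚ.* ε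
        ≡⟨ half+half ε ⟩
      ε ∎
  where
  open ℚ.≤-Reasoning
  lemma : ∀ a b c d → a ℚ.* c ℚ.- b ℚ.* d ≡ a ℚ.* (c ℚ.- d) ℚ.+ d ℚ.* (a ℚ.- b)
  lemma = solve 4 (λ a b c d → a :* c :- b :* d := a :* (c :- d) :+ d :* (a :- b)) refl
    where open ℚ-Solver

-- The operations act termwise, so the algebraic identities hold at each index by those of ℚ.
-- Implicit arguments are supplied because `_≃ᴿ_` unfolds to a statement about sequences, from which
-- the Cauchy proofs cannot be inferred.
ℝ-commutativeRing : CommutativeRing 0ℓ 0ℓ
ℝ-commutativeRing = record
  { RawRing ℝ-rawRing
  ; isCommutativeRing = record
    { isRing = record
      { +-isAbelianGroup = record
        { isGroup = record
          { isMonoid = record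
            { isSemigroup = record
              { isMagma = record
                { isEquivalence = record
                  { refl  = λ {x} → ≃ᴿ-refl {x}
                  ; sym   = λ {x} {y} → ≃ᴿ-sym {x} {y}
                  ; trans = λ {x} {y} {z} → ≃ᴿ-trans {x} {y} {z}
                  }
                ; ∙-cong = λ {x} {x′} {y} {y′} → +ᴿ-cong {x} {x′} {y} {y′}
                }
              ; assoc = λ x y z → ≗⇒≃ᴿ {(x +ᴿ y) +ᴿ z} {x +ᴿ (y +ᴿ z)}
                  λ n → ℚ.+-assoc (seq x n) (seq y n) (seq z n)
              }
            ; identity = (λ x → ≗⇒≃ᴿ {fromℚ 0ℚ +ᴿ x} {x} λ n → ℚ.+-identityˡ (seq x n))
                       , (λ x → ≗⇒≃ᴿ {x +ᴿ fromℚ 0ℚ} {x} λ n → ℚ.+-identityʳ (seq x n))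
            }
          ; inverse = (λ x → ≗⇒≃ᴿ {(-ᴿ x) +ᴿ x} {fromℚ 0ℚ} λ n → ℚ.+-inverseˡ (seq x n))
                    , (λ x → ≗⇒≃ᴿ {x +ᴿ -ᴿ x} {fromℚ 0ℚ} λ n → ℚ.+-inverseʳ (seq x n))
          ; ⁻¹-cong = λ {x} {y} → -ᴿ-cong {x} {y}
          }
        ; comm = λ x y → ≗⇒≃ᴿ {x +ᴿ y} {y +ᴿ x} λ n → ℚ.+-comm (seq x n) (seq y n)
        }
      ; *-cong = λ {x} {x′} {y} {y′} → *ᴿ-cong {x} {x′} {y} {y′}
      ; *-assoc = λ x y z → ≗⇒≃ᴿ {(x *ᴿ y) *ᴿ z} {x *ᴿ (y *ᴿ z)}
          λ n → ℚ.*-assoc (seq x n) (seq y n) (seq z n)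
      ; *-identity = (λ x → ≗⇒≃ᴿ {fromℚ 1ℚ *ᴿ x} {x} λ n → ℚ.*-identityˡ (seq x n))
                   , (λ x → ≗⇒≃ᴿ {x *ᴿ fromℚ 1ℚ} {x} λ n → ℚ.*-identityʳ (seq x n))
      ; distrib = (λ x y z → ≗⇒≃ᴿ {x *ᴿ (y +ᴿ z)} {x *ᴿ y +ᴿ x *ᴿ z}
                      λ n → ℚ.*-distribˡ-+ (seq x n) (seq y n) (seq z n))
                , (λ x y z → ≗⇒≃ᴿ {(y +ᴿ z) *ᴿ x} {y *ᴿ x +ᴿ z *ᴿ x}
                      λ n → ℚ.*-distribʳ-+ (seq x n) (seq y n) (seq z n))
      }
    ; *-comm = λ x y → ≗⇒≃ᴿ {x *ᴿ y} {y *ᴿ x} λ n → ℚ.*-comm (seq x n) (seq y n)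
    }
  }

module ℝ-Algebra = ℚ-Algebra fromℚ (CommutativeRing.isCommutativeRing ℝ-commutativeRing)
  (λ p q → ≗⇒≃ᴿ {fromℚ (p ℚ.+ q)} {fromℚ p +ᴿ fromℚ q} λ _ → refl)
  (λ p q → ≗⇒≃ᴿ {fromℚ (p ℚ.* q)} {fromℚ p *ᴿ fromℚ q} λ _ → refl)
  (λ p → ≗⇒≃ᴿ {fromℚ (ℚ.- p)} {y = -ᴿ fromℚ p} λ _ → refl)

-- Square roots

/-*-homo : ∀ a b k l → (+ a / suc k) ℚ.* (+ b / suc l) ≡ + (a ℕ.* b) / (suc k ℕ.* suc l)
/-*-homo a b k l = ℚ.toℚᵘ-injective (begin
  ℚ.toℚᵘ ((+ a / suc k) ℚ.* (+ b / suc l))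
    ≈⟨ ℚ.toℚᵘ-homo-* (+ a / suc k) (+ b / suc l) ⟩
  ℚ.toℚᵘ (+ a / suc k) ℚᵘ.* ℚ.toℚᵘ (+ b / suc l)
    ≈⟨ ℚᵘ.*-cong (ℚ.toℚᵘ-fromℚᵘ (ℚᵘ.mkℚᵘ (+ a) k)) (ℚ.toℚᵘ-fromℚᵘ (ℚᵘ.mkℚᵘ (+ b) l)) ⟩
  -- `mkℚᵘ` takes the denominator minus one, and `suc k ℕ.* suc l` reduces to
  -- `suc (l ℕ.+ k ℕ.* suc l)`.
  ℚᵘ.mkℚᵘ (+ a ℤ.* + b) (l ℕ.+ k ℕ.* suc l)
    ≡⟨ cong (λ z → ℚᵘ.mkℚᵘ z (l ℕ.+ k ℕ.* suc l)) (sym (ℤ.pos-* a b)) ⟩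
  ℚᵘ.mkℚᵘ (+ (a ℕ.* b)) (l ℕ.+ k ℕ.* suc l)
    ≈⟨ ℚᵘ.≃-sym (ℚ.toℚᵘ-fromℚᵘ (ℚᵘ.mkℚᵘ (+ (a ℕ.* b)) (l ℕ.+ k ℕ.* suc l))) ⟩
  ℚ.toℚᵘ (+ (a ℕ.* b) / (suc k ℕ.* suc l)) ∎)
  where open ℚᵘ.≃-Reasoning

-- This is r² ≤ n(k+1)² divided by (k+1)².
√-seq-lower : ∀ n k → √-seq n k ℚ.* √-seq n k ℚ.≤ + n / 1
√-seq-lower n k = subst (ℚ._≤ + n / 1) (sym (/-*-homo r r k k))
  (/-mono-≤ (r ℕ.* r) n (k ℕ.+ k ℕ.* suc k) 0
    (subst (ℕ._≤ n ℕ.* (suc k ℕ.* suc k)) (sym (ℕ.*-identityʳ (r ℕ.* r))) (⌊√⌋-lower (n ℕ.* (suc k ℕ.* suc k)))))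
  where r = ⌊√ n ℕ.* (suc k ℕ.* suc k) ⌋

-- Here `u` is (r+1)/(k+1), one grid step above the approximation, and n(k+1)² < (r+1)².
√-seq-upper : ∀ n k → let u = √-seq n k ℚ.+ + 1 / suc k in + n / 1 ℚ.≤ u ℚ.* u
√-seq-upper n k = subst (+ n / 1 ℚ.≤_)
  (trans (sym (/-*-homo (suc r) (suc r) k k)) (cong₂ ℚ._*_ (suc/ r k) (suc/ r k)))
  (/-mono-≤ n (suc r ℕ.* suc r) 0 (k ℕ.+ k ℕ.* suc k)
    (subst (n ℕ.* (suc k ℕ.* suc k) ℕ.≤_) (sym (ℕ.*-identityʳ (suc r ℕ.* suc r)))
      (ℕ.<⇒≤ (⌊√⌋-upper (n ℕ.* (suc k ℕ.* suc k))))))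
  where r = ⌊√ n ℕ.* (suc k ℕ.* suc k) ⌋

-- With s the k-th approximation and t = 1/(k+1), n lies between s² and (s+t)². These differ by
-- (2s+t)t, which tends to 0 because s stays bounded.
√-square : ∀ n → √ n *ᴿ √ n ≃ᴿ fromℕ n
√-square n ε ε>0 =
  let (B , B>0 , K , s≤B) = eventually-bounded (√ n)
      -- Bounds 2s + t, since s ≤ B and t ≤ 1.
      C = (B ℚ.+ B) ℚ.+ 1ℚ
      C>0 = ℚ.+-mono-< (ℚ.+-mono-< B>0 B>0) (ℚ.positive⁻¹ 1ℚ)
      (C⁻¹ , C⁻¹>0 , CC⁻¹≡1) = 1/>0 C>0
      (N , small) = archimedean (C⁻¹ ℚ.* ε) (*>0 C⁻¹>0 ε>0)
  in K ℕ.⊔ N , λ k ≤k →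
    let s = √-seq n k
        t = + 1 / suc k
        s≥0 = /-mono-≤ 0 ⌊√ n ℕ.* (suc k ℕ.* suc k) ⌋ 0 k ℕ.z≤n
        s≤ = ℚ.≤-trans (ℚ.≤-reflexive (sym (ℚ.0≤p⇒∣p∣≡p s≥0))) (s≤B k (ℕ.m⊔n≤o⇒m≤o K N ≤k))
        t≤1 = /-mono-≤ 1 1 k 0 (ℕ.s≤s ℕ.z≤n)
        t≥0 = /-mono-≤ 0 1 0 k ℕ.z≤n
        gap≥0 = subst (ℚ._≤ + n / 1 ℚ.- s ℚ.* s) (ℚ.+-inverseʳ (s ℚ.* s))
          (ℚ.+-monoˡ-≤ (ℚ.- (s ℚ.* s)) (√-seq-lower n k))
    in begin-strict
      ∣ s ℚ.* s ℚ.- + n / 1 ∣                          ≡⟨ ∣-∣-sym (s ℚ.* s) (+ n / 1) ⟩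
      ∣ + n / 1 ℚ.- s ℚ.* s ∣                          ≡⟨ ℚ.0≤p⇒∣p∣≡p gap≥0 ⟩
      + n / 1 ℚ.- s ℚ.* s                              ≤⟨ ℚ.+-monoˡ-≤ (ℚ.- (s ℚ.* s)) (√-seq-upper n k) ⟩
      (s ℚ.+ t) ℚ.* (s ℚ.+ t) ℚ.- s ℚ.* s              ≡⟨ lemma s t ⟩
      ((s ℚ.+ s) ℚ.+ t) ℚ.* t                          ≤⟨ ℚ.*-monoʳ-≤-nonNeg t {{ℚ.nonNegative t≥0}}
                                                            (ℚ.+-mono-≤ (ℚ.+-mono-≤ s≤ s≤) t≤1) ⟩
      C ℚ.* t                                          <⟨ ℚ.*-monoʳ-<-pos C {{ℚ.positive C>0}}
                                                            (small k (ℕ.m⊔n≤o⇒n≤o K N ≤k)) ⟩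
      C ℚ.* (C⁻¹ ℚ.* ε)                                ≡⟨ scaled C C⁻¹ ε CC⁻¹≡1 ⟩
      ε                                                ∎
  where
  open ℚ.≤-Reasoning
  lemma : ∀ s t → (s ℚ.+ t) ℚ.* (s ℚ.+ t) ℚ.- s ℚ.* s ≡ ((s ℚ.+ s) ℚ.+ t) ℚ.* t
  lemma = solve 2 (λ s t → (s :+ t) :* (s :+ t) :- s :* s := ((s :+ s) :+ t) :* t) refl
    where open ℚ-Solver

-- From index `K` on the terms are nonzero and each product is exactly 1, so `K` serves for every
-- `ε`.
⁻¹-inverseʳ : ∀ x (x#0 : Apart₀ x) → x *ᴿ x ⁻¹[ x#0 ] ≃ᴿ fromℚ 1ℚ
⁻¹-inverseʳ x (δ , δ>0 , K , δ≤∣x∣) ε ε>0 = K , λ n K≤n →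
  subst (λ z → ∣ z ℚ.- 1ℚ ∣ ℚ.< ε) (sym (invℚ-inverse (≢0 (seq x n) (δ≤∣x∣ n K≤n)))) ε>0
  where
  ≢0 : ∀ q → δ ℚ.≤ ∣ q ∣ → q ≢ 0ℚ
  ≢0 _ δ≤q refl = ℚ.<-irrefl refl (ℚ.<-≤-trans δ>0 δ≤q)

-- The reciprocal `q` is given through its equation, so that the concrete cases 1, 2 and 4 are
-- settled by `refl`.
1/√-square : ∀ n q → (+ suc n / 1) ℚ.* q ≡ 1ℚ → 1/√ suc n *ᴿ 1/√ suc n ≃ᴿ fromℚ q
1/√-square n q nq≡1 =
  ℝ-Algebra.inverse-square {√ suc n} {1/√ suc n} {fromℕ (suc n)} {fromℚ q}
    (√-square (suc n)) (⁻¹-inverseʳ (√ suc n) (√-apart₀ n))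
    (≗⇒≃ᴿ {fromℕ (suc n) *ᴿ fromℚ q} {fromℚ 1ℚ} λ _ → nq≡1)

-- Energies

open RawMonoidDefs (RawRing.+-rawMonoid ℝ-rawRing) using (sum)

emptyGraph-energy : RandićEnergyIs emptyGraph (fromℕ 0)
-- The determinant of the empty matrix and the empty product of roots are both 1.
emptyGraph-energy = (λ ()) , (λ _ → ≃ᴿ-refl {fromℚ 1ℚ}) , ≃ᴿ-refl {fromℕ 0}

addEdge-spectrum : ∀ G {ρ : Vector ℝ (SimpleGraph.order G)} →
  Spectrum ℝ-rawRing (randićMatrix G) ρ →
  Spectrum ℝ-rawRing (randićMatrix (addEdge G)) (fromℚ 1ℚ ∷ fromℚ (ℚ.- 1ℚ) ∷ ρ)
-- `randićMatrix` is `weightedAdjacency` with weight `1/√_` by unfolding.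
addEdge-spectrum G = ℝ-Algebra.addEdge-spectrum 1/√_ G (1/√-square 0 1ℚ refl)

path₄-spectrum : Spectrum ℝ-rawRing (randićMatrix path₄)
  (fromℚ 1ℚ ∷ fromℚ (ℚ.- 1ℚ) ∷ fromℚ ½ ∷ fromℚ (ℚ.- ½) ∷ [])
path₄-spectrum = ℝ-Algebra.path₄-spectrum 1/√_ (1/√-square 1 ½ refl) (1/√-square 3 (½ ℚ.* ½) refl)

-- `∣ fromℚ p ∣ᴿ` and `fromℚ ∣ p ∣` share one sequence and may differ only in the Cauchy proof. A
-- rational eigenvalue thus adds to the energy inside ℚ.
sum-∣fromℚ∷∣ : ∀ {n} p {q} (ρ : Vector ℝ n) → sum (λ i → ∣ ρ i ∣ᴿ) ≃ᴿ fromℚ q →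
  sum (λ i → ∣ (fromℚ p ∷ ρ) i ∣ᴿ) ≃ᴿ fromℚ (∣ p ∣ ℚ.+ q)
sum-∣fromℚ∷∣ p {q} ρ energy =
  +ᴿ-cong {fromℚ ∣ p ∣} {fromℚ ∣ p ∣} {sum (λ i → ∣ ρ i ∣ᴿ)} {fromℚ q} (≃ᴿ-refl {fromℚ ∣ p ∣}) energy

1+1+m≡2+m : ∀ m → 1ℚ ℚ.+ (1ℚ ℚ.+ + m / 1) ≡ + suc (suc m) / 1
1+1+m≡2+m m = sym (trans (suc/ (suc m) 0) (trans (ℚ.+-comm (+ suc m / 1) 1ℚ)
  (cong (1ℚ ℚ.+_) (trans (suc/ m 0) (ℚ.+-comm (+ m / 1) 1ℚ)))))

energyIs : ∀ G {r} (ρ : Vector ℝ (SimpleGraph.order G)) →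
  Spectrum ℝ-rawRing (randićMatrix G) ρ → sum (λ i → ∣ ρ i ∣ᴿ) ≃ᴿ r → RandićEnergyIs G r
energyIs G ρ (spectrum isEig) energy = ρ , isEig , energy

addEdge-energy : ∀ G {m} → RandićEnergyIs G (fromℕ m) →
  RandićEnergyIs (addEdge G) (fromℕ (suc (suc m)))
addEdge-energy G {m} (ρ , isEig , energy) =
  energyIs (addEdge G) {fromℕ (suc (suc m))} (fromℚ 1ℚ ∷ fromℚ (ℚ.- 1ℚ) ∷ ρ)
    (addEdge-spectrum G (spectrum isEig))
    (subst (λ q → sum (λ i → ∣ (fromℚ 1ℚ ∷ fromℚ (ℚ.- 1ℚ) ∷ ρ) i ∣ᴿ) ≃ᴿ fromℚ q) (1+1+m≡2+m m)
      (sum-∣fromℚ∷∣ 1ℚ {1ℚ ℚ.+ + m / 1} (fromℚ (ℚ.- 1ℚ) ∷ ρ)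
        (sum-∣fromℚ∷∣ (ℚ.- 1ℚ) {+ m / 1} ρ energy)))

path₄-energy : RandićEnergyIs path₄ (fromℕ 3)
path₄-energy = energyIs path₄ {fromℕ 3} (fromℚ 1ℚ ∷ fromℚ (ℚ.- 1ℚ) ∷ fromℚ ½ ∷ fromℚ (ℚ.- ½) ∷ [])
  path₄-spectrum
  -- The absolute values are already evaluated; what remains is 1 + 1 + 1/2 + 1/2 = 3 in ℚ.
  (≗⇒≃ᴿ {fromℚ 1ℚ +ᴿ (fromℚ 1ℚ +ᴿ (fromℚ ½ +ᴿ (fromℚ ½ +ᴿ fromℚ 0ℚ)))} {fromℕ 3} λ _ → refl)

corollary1 : (m : ℕ) → 2 ≤ m → Σ SimpleGraph (λ G → RandićEnergyIs G (fromℕ m))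
corollary1 1 (ℕ.s≤s ())
corollary1 2 _ = addEdge emptyGraph , addEdge-energy emptyGraph {0} emptyGraph-energy
corollary1 3 _ = path₄ , path₄-energy
-- The pattern keeps `m` at least 2, so the descent by two stops at 2 or 3 according to parity.
corollary1 (suc (suc m@(suc (suc _)))) _ =
  let (G , energy) = corollary1 m (ℕ.s≤s (ℕ.s≤s ℕ.z≤n))
  in addEdge G , addEdge-energy G {m} energy
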